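{- Let $X$ be a finite set. The order complex $$\triangle\bigl(\operatorname{Bip}(X)\setminus\{\emptyset,X\times X\}\bigr)$$ is not Cohen--Macaulay.
   Context: A relation $U\subseteq X\times X$ on a finite set $X$ is bipartitional if both $U$ and $(X\times X)\setminus U$ are transitive. $\operatorname{Bip}(X)$ is the set of bipartitional relations on $X$, partially ordered by inclusion; its minimum is $\emptyset$ and its maximum is $X\times X$. The order complex $\triangle(Q)$ of a partially ordered set $Q$ is the simplicial complex whose vertices are the elements of $Q$ and whose faces are the chains of $Q$. Cohen--Macaulay is meant in the usual sense: a finite simplicial complex is Cohen--Macaulay (over a given coefficient field, or over $\mathbb{Z}$) if for every face, including the empty face, the reduced homology of its link vanishes in all degrees below the dimension of the link.
   Formalization: The formal theorem assumes that X has at least two elements; for |X| ≤ 1 the poset Bip(X)∖{∅, X×X} is empty, its order complex is {∅}, which is Cohen–Macaulay, so the claim fails there. -}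

module Defs where

open import Algebra.Bundles using (CommutativeRing)
import Algebra.Properties.CommutativeMonoid.Sum as Sum
open import Data.Bool.Base using (Bool; true; false; T; if_then_else_)
open import Data.Bool.Properties using (T?) renaming (_≟_ to _Bool≟_)
open import Data.Empty using (⊥-elim)
open import Data.Fin.Base using (Fin; zero; suc; finToFun; funToFin)
open import Data.Fin.Properties using (all?; finToFun-funToFin; 2↔Bool)
open import Data.Fin.Subset using (Subset; inside; outside; _∈_; _⊆_; _∪_; _∩_; ⁅_⁆; ∣_∣; Empty)
  renaming (⊥ to ∅)
open import Data.Fin.Subset.Properties
  using (_∈?_; nonempty?; ∪-identityʳ; x∈p∩q⁺; x∈p∩q⁻; x∈p∪q⁺; x∈p∪q⁻; ∉⊥)
open import Data.Integer.Base as ℤ using (ℤ; +_)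
open import Data.List.Base using (List; []; _∷_; length; lookup; map; deduplicate; allFin)
open import Data.List.Membership.Propositional.Properties using (∈-allFin)
open import Data.List.Relation.Unary.All using (All; []; _∷_)
open import Data.List.Relation.Unary.AllPairs using ([]; _∷_)
open import Data.List.Relation.Unary.Any using (Any; here; there; index)
import Data.List.Relation.Unary.Any as Any
open import Data.List.Relation.Unary.Any.Properties using (lookup-index; map⁺)
open import Data.List.Relation.Unary.Enumerates.Setoid using (IsEnumeration)
open import Data.List.Relation.Unary.Enumerates.Setoid.Properties using (deduplicate⁺)
open import Data.List.Relation.Unary.Unique.Setoid using (Unique)
open import Data.List.Relation.Unary.Unique.DecSetoid.Properties using (deduplicate-!)
open import Data.Nat.Base using (ℕ; _^_)
open import Data.Product.Base using (Σ; ∃-syntax; _×_; _,_; proj₁; proj₂)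
open import Data.Sum.Base using (_⊎_; map₂)
open import Data.Unit.Base using (tt)
open import Data.Vec.Base using (_∷_)
open import Function.Bundles using (Inverse; _↔_)
open import Level using (0ℓ; _⊔_)
open import Relation.Binary.Bundles using (Setoid; DecSetoid; DecPoset)
import Relation.Binary.Construct.On as On
open import Relation.Binary.Core using (Rel)
open import Relation.Binary.Definitions using (Transitive)
open import Relation.Binary.PropositionalEquality.Core as ≡ using (_≡_; refl; sym; trans; cong; subst)
import Relation.Binary.PropositionalEquality.Properties as ≡
open import Relation.Nullary using (¬_; Dec; yes; no; does; contradiction)
open import Relation.Nullary.Decidable using (map′; ¬?; _×-dec_; _⊎-dec_; _→-dec_)
open import Relation.Unary using (Pred; Decidable)

-- Not every element of the ground set Fin m has to be a vertex: a link
-- is taken on the ground set of the ambient complex.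
record SimplicialComplex (m : ℕ) : Set₁ where
  field
    Face    : Pred (Subset m) 0ℓ
    face?   : Decidable Face
    ∅-face  : Face ∅
    ⊆-close : ∀ {σ τ} → σ ⊆ τ → Face τ → Face σ

open SimplicialComplex public

link : ∀ {m} (K : SimplicialComplex m) (σ : Subset m) → Face K σ → SimplicialComplex m
link K σ σ∈K = record
  { Face    = λ τ → Empty (σ ∩ τ) × Face K (σ ∪ τ)
  ; face?   = λ τ → ¬? (nonempty? (σ ∩ τ)) ×-dec face? K (σ ∪ τ)
  ; ∅-face  = (λ (_ , x∈) → ∉⊥ (proj₂ (x∈p∩q⁻ σ ∅ x∈)))
            , subst (Face K) (sym (∪-identityʳ σ)) σ∈K
  ; ⊆-close = λ {ρ} {τ} ρ⊆τ (disj , σ∪τ∈K) →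
        (λ (x , x∈) → let (x∈σ , x∈ρ) = x∈p∩q⁻ σ ρ x∈ in disj (x , x∈p∩q⁺ (x∈σ , ρ⊆τ x∈ρ)))
      , ⊆-close K (λ x∈ → x∈p∪q⁺ (map₂ ρ⊆τ (x∈p∪q⁻ σ ρ x∈))) σ∪τ∈K
  }

dim : ∀ {m} → Subset m → ℤ
dim σ = ℤ.pred (+ ∣ σ ∣)

HasDimension : ∀ {m} → SimplicialComplex m → ℤ → Set
HasDimension K d = (∃[ σ ] Face K σ × dim σ ≡ d) × (∀ σ → Face K σ → dim σ ℤ.≤ d)

Nontrivial : ∀ {c ℓ} → CommutativeRing c ℓ → Set ℓ
Nontrivial R = ¬ (1# ≈ 0#)
  where open CommutativeRing R using (_≈_; 0#; 1#)

module _ {c ℓ} (R : CommutativeRing c ℓ) where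

  open CommutativeRing R using (Carrier; _≈_; 0#; -_; +-commutativeMonoid)
  open Sum +-commutativeMonoid using (sum)

  -- An element of the free module on the i-dimensional faces, as the
  -- function assigning to each face its coefficient; the faces are
  -- oriented by the order of Fin m.
  record Chain {m} (K : SimplicialComplex m) (i : ℤ) : Set (c ⊔ ℓ) where
    field
      coeff     : Subset m → Carrier
      supported : ∀ σ → ¬ (Face K σ × dim σ ≡ i) → coeff σ ≈ 0#

  open Chain public

  -- (-1)^j r, where j is the number of elements of σ smaller than v.
  signed : ∀ {m} → Fin m → Subset m → Carrier → Carrier
  signed zero    _             r = r
  signed (suc v) (inside  ∷ σ) r = - signed v σ r
  signed (suc v) (outside ∷ σ) r = signed v σ r

  -- The coefficients of the boundary of the chain with coefficients a,
  -- where ∂ {v₀ < … < vₖ} = Σⱼ (-1)^j ({v₀ < … < vₖ} ∖ {vⱼ}).  A face σ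
  -- arises exactly from the faces σ ∪ {v} with v ∉ σ, and v is then
  -- preceded in σ ∪ {v} by the elements of σ smaller than v.  Since ∅ is
  -- among the faces this is the augmented (reduced) complex.
  ∂ : ∀ {m} → (Subset m → Carrier) → (Subset m → Carrier)
  ∂ a σ = sum λ v → if does (v ∈? σ) then 0# else signed v σ (a (σ ∪ ⁅ v ⁆))

  IsCycle : ∀ {m} {K : SimplicialComplex m} {i} → Chain K i → Set ℓ
  IsCycle z = ∀ σ → ∂ (coeff z) σ ≈ 0#

  IsBoundary : ∀ {m} {K : SimplicialComplex m} {i} → Chain K i → Set (c ⊔ ℓ)
  IsBoundary {K = K} {i} z = ∃[ b ] (∀ σ → ∂ (coeff {K = K} {i = ℤ.suc i} b) σ ≈ coeff z σ)

  ReducedHomologyVanishes : ∀ {m} → SimplicialComplex m → ℤ → Set (c ⊔ ℓ)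
  ReducedHomologyVanishes K i = (z : Chain K i) → IsCycle z → IsBoundary z

  CohenMacaulay : ∀ {m} → SimplicialComplex m → Set (c ⊔ ℓ)
  CohenMacaulay K = ∀ σ (σ∈K : Face K σ) d → HasDimension (link K σ σ∈K) d →
                    ∀ i → i ℤ.< d → ReducedHomologyVanishes (link K σ σ∈K) i

Finite : ∀ {a ℓ} → Setoid a ℓ → Set (a ⊔ ℓ)
Finite S = ∃[ m ] Inverse (≡.setoid (Fin m)) S

orderComplex : (P : DecPoset 0ℓ 0ℓ 0ℓ) (fin : Finite (DecPoset.Eq.setoid P)) →
               SimplicialComplex (proj₁ fin)
orderComplex P (m , enum) = record
  { Face    = IsChain
  ; face?   = λ σ → all? λ x → all? λ y → (x ∈? σ) →-dec ((y ∈? σ) →-dec comparable? x y)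
  ; ∅-face  = λ _ _ x∈ → contradiction x∈ ∉⊥
  ; ⊆-close = λ σ⊆τ τ-chain x y x∈ y∈ → τ-chain x y (σ⊆τ x∈) (σ⊆τ y∈)
  }
  where
  open DecPoset P using (_≤_; _≤?_)
  open Inverse enum using (to)

  IsChain : Pred (Subset m) 0ℓ
  IsChain σ = ∀ x y → x ∈ σ → y ∈ σ → to x ≤ to y ⊎ to y ≤ to x

  comparable? : ∀ x y → Dec (to x ≤ to y ⊎ to y ≤ to x)
  comparable? x y = (to x ≤? to y) ⊎-dec (to y ≤? to x)

module _ {a ℓ} (S? : DecSetoid a ℓ) where

  open DecSetoid S? using (_≈_; _≟_) renaming (Carrier to A; setoid to S; sym to ≈-sym; trans to ≈-trans)

  private
    lookup-All : ∀ {p} {P : Pred A p} {xs} → All P xs → ∀ i → P (lookup xs i)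
    lookup-All (px ∷ _)   zero    = px
    lookup-All (_  ∷ pxs) (suc i) = lookup-All pxs i

    lookup-injective : ∀ {xs} → Unique S xs → ∀ i j → lookup xs i ≈ lookup xs j → i ≡ j
    lookup-injective (_  ∷ _)  zero    zero    _  = refl
    lookup-injective (x∉ ∷ _)  zero    (suc j) eq = contradiction eq (lookup-All x∉ j)
    lookup-injective (x∉ ∷ _)  (suc i) zero    eq = contradiction (≈-sym eq) (lookup-All x∉ i)
    lookup-injective (_  ∷ xs) (suc i) (suc j) eq = cong suc (lookup-injective xs i j eq)

  enumeration⇒finite : (xs : List A) → IsEnumeration S xs → Finite S
  enumeration⇒finite xs xs-enum = length ys , record
    { to        = lookup ys
    ; from      = position
    ; to-cong   = λ { refl → DecSetoid.refl S? }
    ; from-cong = λ {x} {y} x≈y → lookup-injective ys-unique _ _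
                    (≈-trans (≈-sym (at x)) (≈-trans x≈y (at y)))
    ; inverse   = (λ { {x} refl → ≈-sym (at x) })
                , (λ {i} {x} x≈ → lookup-injective ys-unique _ _ (≈-trans (≈-sym (at x)) x≈))
    }
    where
    ys : List A
    ys = deduplicate _≟_ xs

    ys-enum : IsEnumeration S ys
    ys-enum = deduplicate⁺ S? xs-enum

    ys-unique : Unique S ys
    ys-unique = deduplicate-! S? xs

    position : A → Fin (length ys)
    position x = index (ys-enum x)

    at : ∀ x → x ≈ lookup ys (position x)
    at x = lookup-index (ys-enum x)

  module _ {p} {P : Pred A p} (P? : Decidable P) (P-resp : ∀ {x y} → x ≈ y → P x → P y) where

    private
      restrict : List A → List (Σ A P)
      restrict []       = []
      restrict (x ∷ xs) with P? x
      ... | yes px = (x , px) ∷ restrict xs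
      ... | no  _  = restrict xs

      restrict⁺ : ∀ {xs} (y : Σ A P) → Any (proj₁ y ≈_) xs → Any (λ z → proj₁ y ≈ proj₁ z) (restrict xs)
      restrict⁺ {x ∷ xs} y y∈ with P? x | y∈
      ... | yes px | here  y≈x = here y≈x
      ... | yes px | there y∈′ = there (restrict⁺ y y∈′)
      ... | no ¬px | here  y≈x = contradiction (P-resp y≈x (proj₂ y)) ¬px
      ... | no ¬px | there y∈′ = restrict⁺ y y∈′

    subset-enumeration : ∀ xs → IsEnumeration S xs →
                         ∃[ ys ] IsEnumeration (On.setoid S (proj₁ {B = P})) ys
    subset-enumeration xs xs-enum = restrict xs , λ y → restrict⁺ y (xs-enum (proj₁ y))

-- A subset of X × X, given by its characteristic function; classically
-- this is no restriction.
Relation : Set → Set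
Relation X = X → X → Bool

⟦_⟧ : ∀ {X} → Relation X → Rel X 0ℓ
⟦ U ⟧ x y = T (U x y)

∁⟦_⟧ : ∀ {X} → Relation X → Rel X 0ℓ
∁⟦ U ⟧ x y = ¬ T (U x y)

IsBipartitional : ∀ {X} → Relation X → Set
IsBipartitional U = Transitive ⟦ U ⟧ × Transitive ∁⟦ U ⟧

Bip : Set → Set
Bip X = Σ (Relation X) IsBipartitional

emptyRel fullRel : ∀ {X} → Bip X
emptyRel = (λ _ _ → false) , (λ ()) , (λ _ _ ())
fullRel  = (λ _ _ → true) , (λ _ _ → tt) , (λ p _ → ⊥-elim (p tt))

module _ {X : Set} {n : ℕ} (X-fin : Fin n ↔ X) where

  private
    open Inverse X-fin using (to; from; strictlyInverseˡ)

    ∀? : ∀ {p} {P : Pred X p} → Decidable P → Dec (∀ x → P x)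
    ∀? {P = P} P? = map′ (λ f x → subst P (strictlyInverseˡ x) (f (from x))) (λ f i → f (to i))
                         (all? λ i → P? (to i))

    T-ext : ∀ a b → (T a → T b) → (T b → T a) → a ≡ b
    T-ext false false _ _ = refl
    T-ext false true  _ g = ⊥-elim (g tt)
    T-ext true  false f _ = ⊥-elim (f tt)
    T-ext true  true  _ _ = refl

  relationPoset : DecPoset 0ℓ 0ℓ 0ℓ
  relationPoset = record
    { Carrier = Relation X
    ; _≈_     = λ U V → ∀ x y → U x y ≡ V x y
    ; _≤_     = λ U V → ∀ x y → ⟦ U ⟧ x y → ⟦ V ⟧ x y
    ; isDecPartialOrder = record
      { isPartialOrder = record
        { isPreorder = record
          { isEquivalence = record
            { refl  = λ _ _ → refl
            ; sym   = λ p x y → sym (p x y)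
            ; trans = λ p q x y → trans (p x y) (q x y)
            }
          ; reflexive = λ p x y → subst T (p x y)
          ; trans     = λ p q x y u → q x y (p x y u)
          }
        ; antisym = λ {U} {V} p q x y → T-ext (U x y) (V x y) (p x y) (q x y)
        }
      ; _≟_  = λ U V → ∀? λ x → ∀? λ y → U x y Bool≟ V x y
      ; _≤?_ = λ U V → ∀? λ x → ∀? λ y → T? (U x y) →-dec T? (V x y)
      }
    }

  bipPoset : DecPoset 0ℓ 0ℓ 0ℓ
  bipPoset = On.decPoset relationPoset (proj₁ {B = IsBipartitional})

  open DecPoset bipPoset using (_≈_; _≉_; _≟_)

  IsProper : Pred (Bip X) 0ℓ
  IsProper U = U ≉ emptyRel × U ≉ fullRel

  properBipPoset : DecPoset 0ℓ 0ℓ 0ℓ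
  properBipPoset = On.decPoset bipPoset (proj₁ {B = IsProper})

  private
    relations : List (Relation X)
    relations = map (λ k x y → Inverse.to 2↔Bool (finToFun (finToFun {2 ^ n} {n} k (from x)) (from y)))
                    (allFin ((2 ^ n) ^ n))

    relations-enum : IsEnumeration (DecPoset.Eq.setoid relationPoset) relations
    relations-enum U = map⁺ (Any.map (λ { refl → decode }) (∈-allFin code))
      where
      row : Fin n → Fin n → Fin 2
      row i j = Inverse.from 2↔Bool (U (to i) (to j))

      code : Fin ((2 ^ n) ^ n)
      code = funToFin (λ i → funToFin (row i))

      decode : ∀ x y → U x y ≡ Inverse.to 2↔Bool (finToFun (finToFun {2 ^ n} {n} code (from x)) (from y))
      decode x y
        rewrite finToFun-funToFin {n} {2 ^ n} (λ i → funToFin (row i)) (from x)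
              | finToFun-funToFin (row (from x)) (from y)
              | strictlyInverseˡ x | strictlyInverseˡ y
              = sym (Inverse.strictlyInverseˡ 2↔Bool (U x y))

    bipartitional? : Decidable (IsBipartitional {X})
    bipartitional? U = transitive? (λ x y → T? (U x y)) ×-dec transitive? (λ x y → ¬? (T? (U x y)))
      where
      transitive? : {_∼_ : Rel X 0ℓ} → (∀ x y → Dec (x ∼ y)) → Dec (Transitive _∼_)
      transitive? _∼?_ = map′ (λ f {x} {y} {z} → f x y z) (λ f x y z → f {x} {y} {z})
        (∀? λ x → ∀? λ y → ∀? λ z → (x ∼? y) →-dec ((y ∼? z) →-dec (x ∼? z)))

    bipartitional-resp : ∀ {U V : Relation X} → (∀ x y → U x y ≡ V x y) →
                         IsBipartitional U → IsBipartitional V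
    bipartitional-resp {U} {V} U≈V (t , t′) =
        (λ {x} {y} {z} p q → ⇒ x z (t (⇐ x y p) (⇐ y z q)))
      , (λ {x} {y} {z} p q r → t′ (λ u → p (⇒ x y u)) (λ u → q (⇒ y z u)) (⇐ x z r))
      where
      ⇒ : ∀ x y → T (U x y) → T (V x y)
      ⇒ x y = subst T (U≈V x y)
      ⇐ : ∀ x y → T (V x y) → T (U x y)
      ⇐ x y = subst T (sym (U≈V x y))

    proper? : Decidable IsProper
    proper? U = ¬? (U ≟ emptyRel) ×-dec ¬? (U ≟ fullRel)

    proper-resp : ∀ {U V} → U ≈ V → IsProper U → IsProper V
    proper-resp U≈V (p , q) = (λ V≈∅ → p (λ x y → trans (U≈V x y) (V≈∅ x y)))
                            , (λ V≈⊤ → q (λ x y → trans (U≈V x y) (V≈⊤ x y)))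

  properBip-finite : Finite (DecPoset.Eq.setoid properBipPoset)
  properBip-finite =
    let bips , bips-enum = subset-enumeration (DecPoset.Eq.decSetoid relationPoset)
                             bipartitional? bipartitional-resp relations relations-enum
        propers , propers-enum = subset-enumeration (DecPoset.Eq.decSetoid bipPoset)
                             proper? (λ {U} {V} → proper-resp {U} {V}) bips bips-enum
    in enumeration⇒finite (DecPoset.Eq.decSetoid properBipPoset) propers propers-enum

{-# OPTIONS --safe #-}

-- Fix two points a, b of X, put A = {a, b}, U = A × (X ∖ A) and V = A × X.
-- Let σ be a largest chain of proper bipartitional relations each of which
-- lies below U or above V.  By maximality σ contains U and V unless they are
-- improper, so the link of σ is the order complex of the open interval (U, V).
-- An element W of this interval is determined by its restriction to A, and
-- exactly one of (a, b), (b, a) lies in W: otherwise transitivity of W or of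
-- its complement forces W = V or W = U.  Comparable elements therefore agree
-- on (a, b), so the link is disconnected, while it has dimension at least 1.
module Submission where

open import Defs
open import Algebra.Bundles using (CommutativeMonoid; CommutativeRing)
import Algebra.Properties.CommutativeMonoid.Sum as Sum
import Algebra.Properties.Ring as RingProperties
open import Data.Bool.Base using (Bool; true; false; T; if_then_else_)
open import Data.Bool.Properties using (T?) renaming (_≟_ to _≟ᵇ_)
open import Data.Empty using (⊥-elim)
open import Data.Fin.Base using (Fin; zero; suc; inject₁; _↑ˡ_)
open import Data.Fin.Patterns using (0F; 1F; 2F)
open import Data.Fin.Properties using (all?) renaming (_≟_ to _≟ᶠ_)
open import Data.Fin.Subset
  using (Subset; inside; outside; _∈_; _∉_; _⊂_; _∪_; _∩_; ⁅_⁆; ∣_∣; Empty) renaming (⊥ to ∅)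
open import Data.Fin.Subset.Properties
  using ( anySubset?; ∣p∣≤n; p⊆p∪q; q⊆p∪q; x∈⁅x⁆; x∈⁅y⁆⇒x≡y; x≢y⇒x∉⁅y⁆; ∣⁅x⁆∣≡1; p⊂q⇒∣p∣<∣q∣
        ; _∈?_; nonempty?; Empty-unique; ∉⊥; ∪-identityˡ; ∪-comm; x∈p∪q⁺; x∈p∪q⁻; x∈p∩q⁺; x∈p∩q⁻)
open import Data.Integer.Base as ℤ using (+_)
import Data.Integer.Properties as ℤₚ
open import Data.Nat.Base using (ℕ; zero; suc; _+_; _≤_; _<_; z≤n; s≤s)
open import Data.Nat.Properties
  using (≤-trans; ≤-refl; ≤-reflexive; m≤m+n; +-suc; +-monoʳ-≤; _<?_; ≮⇒≥; <⇒≱)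
open import Data.Product.Base using (∃-syntax; _×_; _,_; proj₁; proj₂)
open import Data.Sum.Base using (_⊎_; inj₁; inj₂; [_,_]′; swap) renaming (map to ⊎-map)
open import Data.Unit.Base using (tt)
open import Data.Vec.Base using () renaming (_∷_ to _∷ᵥ_)
open import Data.Vec.Properties using (≡-dec)
open import Function.Base using (_∘_; _on_; id; case_of_)
open import Function.Bundles using (Inverse; _↔_)
open import Level using (0ℓ)
open import Relation.Binary.Bundles using (DecPoset)
open import Relation.Binary.Core using (Rel)
open import Relation.Binary.Definitions using (DecidableEquality; Transitive)
open import Relation.Binary.PropositionalEquality.Core
  using (_≡_; _≢_; refl; sym; trans; cong; cong₂; subst)
open import Relation.Nullary using (¬_; Dec; yes; no; does; contradiction)
open import Relation.Nullary.Decidable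
  using (map′; ¬?; _×-dec_; _⊎-dec_; _→-dec_; from-yes; decidable-stable)
open import Relation.Unary using (Pred; Decidable)

-- Largest subsets and dimension

maximum : ∀ {m} {P : Pred (Subset m) 0ℓ} → Decidable P → ∀ σ → P σ →
          ∃[ τ ] P τ × (∀ ρ → P ρ → ∣ ρ ∣ ≤ ∣ τ ∣)
maximum {m} {P} P? σ Pσ = search m σ Pσ (m≤m+n m ∣ σ ∣)
  where
  -- Each round finds a strictly larger subset. The bound `m ≤ k + ∣ σ ∣` is the fuel: once `k` is
  -- zero, `σ` has `m` elements and no subset is larger.
  search : ∀ k σ → P σ → m ≤ k + ∣ σ ∣ → ∃[ τ ] P τ × (∀ ρ → P ρ → ∣ ρ ∣ ≤ ∣ τ ∣)
  search zero    σ Pσ m≤ = σ , Pσ , λ ρ _ → ≤-trans (∣p∣≤n ρ) m≤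
  search (suc k) σ Pσ m≤ with anySubset? (λ ρ → P? ρ ×-dec (∣ σ ∣ <? ∣ ρ ∣))
  ... | yes (ρ , Pρ , σ<ρ) = search k ρ Pρ
          (≤-trans m≤ (≤-trans (≤-reflexive (sym (+-suc k ∣ σ ∣))) (+-monoʳ-≤ k σ<ρ)))
  ... | no ¬larger = σ , Pσ , λ ρ Pρ → ≮⇒≥ (λ σ<ρ → ¬larger (ρ , Pρ , σ<ρ))

x∉p⇒p⊂p∪⁅x⁆ : ∀ {m} {x : Fin m} {p} → x ∉ p → p ⊂ p ∪ ⁅ x ⁆
x∉p⇒p⊂p∪⁅x⁆ {x = x} {p} x∉p = p⊆p∪q ⁅ x ⁆ , x , q⊆p∪q p ⁅ x ⁆ (x∈⁅x⁆ x) , x∉p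

∣p∪⁅x⁆∣>∣p∣ : ∀ {m} {x : Fin m} {p} → x ∉ p → ∣ p ∣ < ∣ p ∪ ⁅ x ⁆ ∣
∣p∪⁅x⁆∣>∣p∣ = p⊂q⇒∣p∣<∣q∣ ∘ x∉p⇒p⊂p∪⁅x⁆

⁅⁆-injective : ∀ {m} {x y : Fin m} → ⁅ x ⁆ ≡ ⁅ y ⁆ → x ≡ y
⁅⁆-injective {x = x} {y} eq = x∈⁅y⁆⇒x≡y y (subst (x ∈_) eq (x∈⁅x⁆ x))

-- A largest face realises the dimension, and an edge forces that face to have at least two
-- elements. This puts degree 0 among those where Cohen-Macaulayness demands vanishing.
edge⇒positiveDimension : ∀ {m} (K : SimplicialComplex m) {v w} → v ≢ w → Face K (⁅ v ⁆ ∪ ⁅ w ⁆) →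
                         ∃[ d ] HasDimension K d × + 0 ℤ.< d
edge⇒positiveDimension K {v} {w} v≢w vw∈K with maximum (face? K) _ vw∈K
... | τ , τ∈K , τ-max = dim τ , ((τ , τ∈K , refl) , λ ρ ρ∈K → ℤₚ.pred-mono (ℤ.+≤+ (τ-max ρ ρ∈K)))
    , ℤₚ.<-≤-trans (ℤ.+<+ ≤-refl) (ℤₚ.pred-mono (ℤ.+≤+ (≤-trans 2≤ (τ-max _ vw∈K))))
  where
  2≤ : 2 ≤ ∣ ⁅ v ⁆ ∪ ⁅ w ⁆ ∣
  2≤ = subst (_< ∣ ⁅ v ⁆ ∪ ⁅ w ⁆ ∣) (∣⁅x⁆∣≡1 v) (∣p∪⁅x⁆∣>∣p∣ (x≢y⇒x∉⁅y⁆ (v≢w ∘ sym)))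

-- Finite sums in a commutative monoid

module _ {c ℓ} (M : CommutativeMonoid c ℓ) where

  open CommutativeMonoid M 
    renaming (_∙_ to _⊕_; ε to 0#; refl to ≈-refl; trans to ≈-trans; sym to ≈-sym)
  open Sum M using (sum; sum-cong-≋; sum-replicate-zero; ∑-distrib-+)
  open import Relation.Binary.Reasoning.Setoid setoid

  sum-zero : ∀ {n} {f : Fin n → Carrier} → (∀ i → f i ≈ 0#) → sum f ≈ 0#
  sum-zero {n} f≈0 = ≈-trans (sum-cong-≋ f≈0) (sum-replicate-zero n)

  sum-single : ∀ {n} {f : Fin n → Carrier} p → (∀ i → i ≢ p → f i ≈ 0#) → sum f ≈ f p
  sum-single {f = f} zero f≈0 = begin
    f zero ⊕ sum (f ∘ suc) ≈⟨ ∙-congˡ (sum-zero (λ i → f≈0 (suc i) λ ())) ⟩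
    f zero ⊕ 0#            ≈⟨ identityʳ _ ⟩
    f zero                 ∎
  sum-single {f = f} (suc p) f≈0 = begin
    f zero ⊕ sum (f ∘ suc) ≈⟨ ∙-cong (f≈0 zero λ ()) (sum-single p λ i i≢p → f≈0 (suc i) λ { refl → i≢p refl }) ⟩
    0# ⊕ f (suc p)         ≈⟨ identityˡ _ ⟩
    f (suc p)              ∎

  -- The vanishing diagonal is needed because 2 may be a zero divisor.
  alternating-sum : ∀ {n} (f : Fin n → Fin n → Carrier) → (∀ i → f i i ≈ 0#) →
                    (∀ i j → f i j ⊕ f j i ≈ 0#) → sum (λ i → sum (f i)) ≈ 0#
  alternating-sum {zero}  f diag anti = ≈-refl
  alternating-sum {suc n} f diag anti = begin
    (f zero zero ⊕ sum row) ⊕ sum (λ i → col i ⊕ sum (inner i))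
      ≈⟨ ∙-cong (∙-congʳ (diag zero)) (∑-distrib-+ col (sum ∘ inner)) ⟩
    (0# ⊕ sum row) ⊕ (sum col ⊕ sum (sum ∘ inner))
      ≈⟨ ∙-cong (identityˡ _) (∙-congˡ (alternating-sum inner (diag ∘ suc) (λ i j → anti (suc i) (suc j)))) ⟩
    sum row ⊕ (sum col ⊕ 0#)   ≈⟨ ∙-congˡ (identityʳ _) ⟩
    sum row ⊕ sum col          ≈⟨ ∑-distrib-+ row col ⟨
    sum (λ i → row i ⊕ col i)  ≈⟨ sum-zero (λ i → anti zero (suc i)) ⟩
    0#                         ∎
    where
    row col : Fin n → Carrier
    row = f zero ∘ suc
    col i = f (suc i) zero

    inner : Fin n → Fin n → Carrier
    inner i j = f (suc i) (suc j)

-- Reduced homology of a disconnected complex in degree 0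

module _ {c ℓ} (R : CommutativeRing c ℓ) where

  open CommutativeRing R
    renaming (_+_ to _⊕_; refl to ≈-refl; sym to ≈-sym; trans to ≈-trans)
  open RingProperties ring using (-0#≈0#)
  open Sum +-commutativeMonoid using (sum; sum-cong-≋; ∑-distrib-+)
  open import Relation.Binary.Reasoning.Setoid setoid

  signed-zero : ∀ {m} (v : Fin m) σ {r} → r ≈ 0# → signed R v σ r ≈ 0#
  signed-zero zero    (_       ∷ᵥ σ) r≈0 = r≈0
  signed-zero (suc v) (inside  ∷ᵥ σ) r≈0 = ≈-trans (-‿cong (signed-zero v σ r≈0)) -0#≈0#
  signed-zero (suc v) (outside ∷ᵥ σ) r≈0 = signed-zero v σ r≈0

  signed-∅ : ∀ {m} (v : Fin m) r → signed R v ∅ r ≈ r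
  signed-∅ zero    r = ≈-refl
  signed-∅ (suc v) r = signed-∅ v r

  -- Of two distinct vertices only the larger is preceded by the other, so the two ends of an edge
  -- enter its boundary with opposite signs.
  signed-antisym : ∀ {m} {v w : Fin m} → v ≢ w → ∀ r → signed R w ⁅ v ⁆ r ⊕ signed R v ⁅ w ⁆ r ≈ 0#
  signed-antisym {v = zero}  {zero}  v≢w r = contradiction refl v≢w
  signed-antisym {v = zero}  {suc w} v≢w r = ≈-trans (+-congʳ (-‿cong (signed-∅ w r))) (-‿inverseˡ r)
  signed-antisym {v = suc v} {zero}  v≢w r = ≈-trans (+-congˡ (-‿cong (signed-∅ v r))) (-‿inverseʳ r)
  signed-antisym {v = suc v} {suc w} v≢w r = signed-antisym (v≢w ∘ cong suc) r

  -- Disconnectedness is witnessed by a two-colouring that is constant along edges and separates `p`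
  -- from `q`; the colour classes need not be connected.
  module _ {m} (K : SimplicialComplex m) {p q : Fin m} (p∈K : Face K ⁅ p ⁆) (q∈K : Face K ⁅ q ⁆)
           (component : Fin m → Bool) (p-side : component p ≡ true) (q-side : component q ≡ false)
           (edge : ∀ v w → Face K (⁅ v ⁆ ∪ ⁅ w ⁆) → component v ≡ component w) where

    private
      _≟ˢ_ : DecidableEquality (Subset m)
      _≟ˢ_ = ≡-dec _≟ᵇ_

      point : Fin m → Subset m → Carrier
      point v σ = if does (σ ≟ˢ ⁅ v ⁆) then 1# else 0#

      point-self : ∀ v → point v ⁅ v ⁆ ≈ 1#
      point-self v with ⁅ v ⁆ ≟ˢ ⁅ v ⁆
      ... | yes _  = ≈-refl
      ... | no  ne = contradiction refl ne

      point-other : ∀ v {σ} → σ ≢ ⁅ v ⁆ → point v σ ≈ 0#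
      point-other v {σ} ne with σ ≟ˢ ⁅ v ⁆
      ... | yes eq = contradiction eq ne
      ... | no  _  = ≈-refl

      z : Subset m → Carrier
      z σ = point p σ ⊕ (- point q σ)

      z-other : ∀ {σ} → σ ≢ ⁅ p ⁆ → σ ≢ ⁅ q ⁆ → z σ ≈ 0#
      z-other ≢p ≢q = ≈-trans (+-cong (point-other p ≢p) (-‿cong (point-other q ≢q))) (-‿inverseʳ 0#)

      dim-point : (v : Fin m) → dim ⁅ v ⁆ ≡ + 0
      dim-point v rewrite ∣⁅x⁆∣≡1 v = refl

      ≢vertex : ∀ {σ v} → Face K ⁅ v ⁆ → ¬ (Face K σ × dim σ ≡ + 0) → σ ≢ ⁅ v ⁆
      ≢vertex {v = v} v∈K ¬face refl = ¬face (v∈K , dim-point v)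

      zChain : Chain R K (+ 0)
      zChain = record
        { coeff     = z
        ; supported = λ σ ¬face → z-other (≢vertex p∈K ¬face) (≢vertex q∈K ¬face)
        }

      p≢q : p ≢ q
      p≢q refl with () ← trans (sym p-side) q-side

      sum-z : sum (λ v → z ⁅ v ⁆) ≈ 0#
      sum-z = begin
        sum (λ v → z ⁅ v ⁆)
          ≈⟨ ∑-distrib-+ (λ v → point p ⁅ v ⁆) (λ v → - point q ⁅ v ⁆) ⟩
        sum (λ v → point p ⁅ v ⁆) ⊕ sum (λ v → - point q ⁅ v ⁆)
          ≈⟨ +-cong (sum-single +-commutativeMonoid p λ v v≢p → point-other p (v≢p ∘ ⁅⁆-injective))
                    (sum-single +-commutativeMonoid q λ v v≢q →
                      ≈-trans (-‿cong (point-other q (v≢q ∘ ⁅⁆-injective))) -0#≈0#) ⟩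
        point p ⁅ p ⁆ ⊕ (- point q ⁅ q ⁆)
          ≈⟨ +-cong (point-self p) (-‿cong (point-self q)) ⟩
        1# ⊕ (- 1#) ≈⟨ -‿inverseʳ 1# ⟩
        0# ∎

      -- At a nonempty `σ` only sets with at least two elements contribute, and `z` vanishes there.
      -- At `∅` the boundary is the augmentation, where the coefficients of `p` and `q` cancel.
      z-cycle : ∀ σ → ∂ R z σ ≈ 0#
      z-cycle σ with nonempty? σ
      ... | yes (x , x∈σ) = sum-zero +-commutativeMonoid term
        where
        term : ∀ v → (if does (v ∈? σ) then 0# else signed R v σ (z (σ ∪ ⁅ v ⁆))) ≈ 0#
        term v with v ∈? σ
        ... | yes _   = ≈-refl
        ... | no  v∉σ = signed-zero v σ (z-other notPoint notPoint)
          where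
          notPoint : ∀ {w} → σ ∪ ⁅ v ⁆ ≢ ⁅ w ⁆
          notPoint {w} eq = v∉σ (subst (_∈ σ) x≡v x∈σ)
            where
            only : ∀ {u} → u ∈ σ ∪ ⁅ v ⁆ → u ≡ w
            only = x∈⁅y⁆⇒x≡y w ∘ subst (_ ∈_) eq
            x≡v : x ≡ v
            x≡v = trans (only (p⊆p∪q ⁅ v ⁆ x∈σ)) (sym (only (q⊆p∪q σ ⁅ v ⁆ (x∈⁅x⁆ v))))
      ... | no empty with refl ← Empty-unique empty = ≈-trans (sum-cong-≋ term) sum-z
        where
        term : ∀ v → (if does (v ∈? ∅) then 0# else signed R v ∅ (z (∅ ∪ ⁅ v ⁆))) ≈ z ⁅ v ⁆
        term v with v ∈? ∅
        ... | yes v∈∅ = contradiction v∈∅ ∉⊥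
        ... | no  _   = ≈-trans (signed-∅ v _) (reflexive (cong z (∪-identityˡ ⁅ v ⁆)))

      -- Zeroing the terms of one side, instead of filtering the indices, keeps every sum indexed by
      -- `Fin m`, as the alternating double sum requires.
      select : Bool → Carrier → Carrier
      select s r = if s then r else 0#

      select-zero : ∀ s {r} → r ≈ 0# → select s r ≈ 0#
      select-zero true  r≈0 = r≈0
      select-zero false _   = ≈-refl

      sum-select : ∀ s {n} (f : Fin n → Carrier) → sum (λ i → select s (f i)) ≈ select s (sum f)
      sum-select true  f = ≈-refl
      sum-select false {n} f = sum-zero +-commutativeMonoid {n} (λ _ → ≈-refl)

      select-antisym : ∀ s {x y} → x ⊕ y ≈ 0# → select s x ⊕ select s y ≈ 0#
      select-antisym true  eq = eq
      select-antisym false _  = +-identityʳ 0#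

      select-cong : ∀ s {x y} → x ≈ y → select s x ≈ select s y
      select-cong true  eq = eq
      select-cong false _  = ≈-refl

    -- The boundary of a 1-chain has coefficient sum 0 on each side,
    -- whereas p - q has coefficient sum 1 on the side of p.
    disconnected⇒¬vanishing : Nontrivial R → ¬ ReducedHomologyVanishes R K (+ 0)
    disconnected⇒¬vanishing 1≉0 vanishes = 1≉0 (begin
      1#                                              ≈⟨ side-sum ⟨
      sum (λ v → select (component v) (z ⁅ v ⁆))      ≈⟨ sum-cong-≋ (λ v → select-cong (component v) (∂b≈z ⁅ v ⁆)) ⟨
      sum (λ v → select (component v) (∂ R b ⁅ v ⁆))  ≈⟨ sum-cong-≋ (λ v → sum-select (component v) (term v)) ⟨
      sum (λ v → sum (λ w → select (component v) (term v w))) ≈⟨ alternating-sum +-commutativeMonoid _ diag anti ⟩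
      0# ∎)
      where
      bounding = vanishes zChain z-cycle
      b = coeff (proj₁ bounding)
      ∂b≈z = proj₂ bounding

      term : Fin m → Fin m → Carrier
      term v w = if does (w ∈? ⁅ v ⁆) then 0# else signed R w ⁅ v ⁆ (b (⁅ v ⁆ ∪ ⁅ w ⁆))

      term-self : ∀ v → term v v ≈ 0#
      term-self v with v ∈? ⁅ v ⁆
      ... | yes _  = ≈-refl
      ... | no  v∉ = contradiction (x∈⁅x⁆ v) v∉

      term-distinct : ∀ {v w} → v ≢ w → term v w ≈ signed R w ⁅ v ⁆ (b (⁅ v ⁆ ∪ ⁅ w ⁆))
      term-distinct {v} {w} v≢w with w ∈? ⁅ v ⁆
      ... | yes w∈ = contradiction (sym (x∈⁅y⁆⇒x≡y v w∈)) v≢w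
      ... | no  _  = ≈-refl

      diag : ∀ v → select (component v) (term v v) ≈ 0#
      diag v = select-zero (component v) (term-self v)

      term-antisym : ∀ {v w} → v ≢ w → term v w ⊕ term w v ≈ 0#
      term-antisym {v} {w} v≢w = begin
        term v w ⊕ term w v
          ≈⟨ +-cong (term-distinct v≢w) (term-distinct (v≢w ∘ sym)) ⟩
        signed R w ⁅ v ⁆ (b (⁅ v ⁆ ∪ ⁅ w ⁆)) ⊕ signed R v ⁅ w ⁆ (b (⁅ w ⁆ ∪ ⁅ v ⁆))
          ≡⟨ cong (λ σ → signed R w ⁅ v ⁆ (b (⁅ v ⁆ ∪ ⁅ w ⁆)) ⊕ signed R v ⁅ w ⁆ (b σ)) (∪-comm ⁅ w ⁆ ⁅ v ⁆) ⟩
        signed R w ⁅ v ⁆ (b (⁅ v ⁆ ∪ ⁅ w ⁆)) ⊕ signed R v ⁅ w ⁆ (b (⁅ v ⁆ ∪ ⁅ w ⁆))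
          ≈⟨ signed-antisym v≢w _ ⟩
        0# ∎

      term-nonface : ∀ {v w} → v ≢ w → ¬ Face K (⁅ v ⁆ ∪ ⁅ w ⁆) → term v w ≈ 0#
      term-nonface {v} {w} v≢w ¬face = ≈-trans (term-distinct v≢w)
        (signed-zero w ⁅ v ⁆ (supported (proj₁ bounding) _ (¬face ∘ proj₁)))

      -- An edge has both ends on one side, so its two terms are kept or dropped together and cancel
      -- if kept. For a non-edge both terms vanish because `b` is supported on faces.
      anti : ∀ v w → select (component v) (term v w) ⊕ select (component w) (term w v) ≈ 0#
      anti v w with v ≟ᶠ w
      ... | yes refl = ≈-trans (+-cong (diag v) (diag v)) (+-identityʳ 0#)
      ... | no v≢w with face? K (⁅ v ⁆ ∪ ⁅ w ⁆)
      ... | yes face rewrite edge v w face = select-antisym (component w) (term-antisym v≢w)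
      ... | no ¬face = ≈-trans
              (+-cong (select-zero (component v) (term-nonface v≢w ¬face))
                      (select-zero (component w) (term-nonface (v≢w ∘ sym)
                        (¬face ∘ subst (Face K) (∪-comm ⁅ w ⁆ ⁅ v ⁆)))))
              (+-identityʳ 0#)

      z-p : z ⁅ p ⁆ ≈ 1#
      z-p = begin
        z ⁅ p ⁆   ≈⟨ +-cong (point-self p) (-‿cong (point-other q (p≢q ∘ ⁅⁆-injective))) ⟩
        1# ⊕ - 0# ≈⟨ +-congˡ -0#≈0# ⟩
        1# ⊕ 0#   ≈⟨ +-identityʳ 1# ⟩
        1#        ∎

      off-p : ∀ v → v ≢ p → select (component v) (z ⁅ v ⁆) ≈ 0#
      off-p v v≢p with v ≟ᶠ q
      ... | yes refl rewrite q-side = ≈-refl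
      ... | no v≢q = select-zero (component v) (z-other (v≢p ∘ ⁅⁆-injective) (v≢q ∘ ⁅⁆-injective))

      side-sum : sum (λ v → select (component v) (z ⁅ v ⁆)) ≈ 1#
      side-sum = begin
        sum (λ v → select (component v) (z ⁅ v ⁆)) ≈⟨ sum-single +-commutativeMonoid p off-p ⟩
        select (component p) (z ⁅ p ⁆)             ≡⟨ cong (λ s → select s (z ⁅ p ⁆)) p-side ⟩
        z ⁅ p ⁆                                    ≈⟨ z-p ⟩
        1#                                         ∎

-- Model relations on three colours

private
  variable
    X Y : Set

infix 4 _⊑_

_⊑_ : Rel (Relation X) 0ℓ
U ⊑ V = ∀ x y → ⟦ U ⟧ x y → ⟦ V ⟧ x y

-- Transitivity pulls back along any map, so finite checks on `Fin 3` settle bipartitionality of the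
-- relations needed on `X`.
on-bipartitional : {t : Relation Y} (f : X → Y) → IsBipartitional t → IsBipartitional (t on f)
on-bipartitional f (t , t′) = (λ {x} {y} {z} → t {f x} {f y} {f z}) , (λ {x} {y} {z} → t′ {f x} {f y} {f z})

-- Relations on X are pulled back along the map sending a to 0, b to 1 and
-- every other point to 2. As ordered partitions, u is ab|rest, v is
-- ab*|rest, w₁ is a|b|rest, w₂ is a*|b|rest and w₃ is b|a|rest, where a block
-- B contributes B × B exactly if it is starred.
u v w₁ w₂ w₃ : Relation (Fin 3)
u 2F _  = false
u _  2F = true
u _  _  = false

v 2F _ = false
v _  _ = true

w₁ 0F 1F = true
w₁ x  y  = u x y

w₂ 0F 0F = true
w₂ x  y  = w₁ x y

w₃ 1F 0F = true
w₃ x  y  = u x y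

bipartitional? : ∀ {n} (t : Relation (Fin n)) → Dec (IsBipartitional t)
bipartitional? t = transitive? (λ x y → T? (t x y)) ×-dec transitive? (λ x y → ¬? (T? (t x y)))
  where
  transitive? : ∀ {n} {_∼_ : Rel (Fin n) 0ℓ} → (∀ x y → Dec (x ∼ y)) → Dec (Transitive _∼_)
  transitive? _∼?_ = map′ (λ f {x} {y} {z} → f x y z) (λ f x y z → f {x} {y} {z})
    (all? λ x → all? λ y → all? λ z → (x ∼? y) →-dec ((y ∼? z) →-dec (x ∼? z)))

_⊑?_ : ∀ {n} (s t : Relation (Fin n)) → Dec (s ⊑ t)
s ⊑? t = all? λ x → all? λ y → T? (s x y) →-dec T? (t x y)

abstract
  u-bipartitional : IsBipartitional u
  u-bipartitional = from-yes (bipartitional? u)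

  v-bipartitional : IsBipartitional v
  v-bipartitional = from-yes (bipartitional? v)

  w₁-bipartitional : IsBipartitional w₁
  w₁-bipartitional = from-yes (bipartitional? w₁)

  w₂-bipartitional : IsBipartitional w₂
  w₂-bipartitional = from-yes (bipartitional? w₂)

  w₃-bipartitional : IsBipartitional w₃
  w₃-bipartitional = from-yes (bipartitional? w₃)

-- The open interval between `U` and `V`

module _ {k : ℕ} (X-fin : Fin (suc (suc k)) ↔ X) where

  open Inverse X-fin using (to; from; strictlyInverseˡ; strictlyInverseʳ)
  open DecPoset (relationPoset X-fin) using (_≤?_)

  -- `point 0F` and `point 1F` are the points a and b.
  point : Fin 2 → X
  point i = to (i ↑ˡ k)

  collapse : Fin (suc (suc k)) → Fin 3
  collapse 0F            = 0F
  collapse 1F            = 1F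
  collapse (suc (suc _)) = 2F

  colour : X → Fin 3
  colour = collapse ∘ from

  colour-point : ∀ i → colour (point i) ≡ inject₁ i
  colour-point 0F = cong collapse (strictlyInverseʳ 0F)
  colour-point 1F = cong collapse (strictlyInverseʳ 1F)

  point⊎rest : ∀ x → (∃[ i ] x ≡ point i) ⊎ colour x ≡ 2F
  point⊎rest x with from x | strictlyInverseˡ x
  ... | 0F          | refl = inj₁ (0F , refl)
  ... | 1F          | refl = inj₁ (1F , refl)
  ... | suc (suc _) | _    = inj₂ refl

  on-point : ∀ (t : Relation (Fin 3)) i j → (t on colour) (point i) (point j) ≡ t (inject₁ i) (inject₁ j)
  on-point t i j = cong₂ t (colour-point i) (colour-point j)

  -- Applied to an element of the interval and to its complement, to exclude that both or neither of
  -- (a, b) and (b, a) are present.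
  transitive⇒full-on-points : {_∼_ : Rel X 0ℓ} → Transitive _∼_ → point 0F ∼ point 1F → point 1F ∼ point 0F →
                              ∀ i j → point i ∼ point j
  transitive⇒full-on-points ∼-trans ab ba 0F 0F = ∼-trans ab ba
  transitive⇒full-on-points ∼-trans ab ba 0F 1F = ab
  transitive⇒full-on-points ∼-trans ab ba 1F 0F = ba
  transitive⇒full-on-points ∼-trans ab ba 1F 1F = ∼-trans ba ab

  U V : Relation X
  U = u on colour
  V = v on colour

  U⊑V : U ⊑ V
  U⊑V x y = from-yes (u ⊑? v) (colour x) (colour y)

  -- Strictness is phrased as non-inclusion, which under `lower` and `upper` amounts to differing
  -- from `U` and `V`, and which directly contradicts `Outside`.
  record Between (W : Relation X) : Set where
    field
      lower  : U ⊑ W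
      upper  : W ⊑ V
      lower≉ : ¬ W ⊑ U
      upper≉ : ¬ V ⊑ W

  open Between

  Between-resp : ∀ {W W′} → (∀ x y → W x y ≡ W′ x y) → Between W → Between W′
  Between-resp {W} {W′} eq bw = record
    { lower  = λ x y → ⇒ x y ∘ lower bw x y
    ; upper  = λ x y → upper bw x y ∘ ⇐ x y
    ; lower≉ = λ le → lower≉ bw (λ x y → le x y ∘ ⇒ x y)
    ; upper≉ = λ le → upper≉ bw (λ x y → ⇐ x y ∘ le x y)
    }
    where
    ⇒ : W ⊑ W′
    ⇒ x y = subst T (eq x y)
    ⇐ : W′ ⊑ W
    ⇐ x y = subst T (sym (eq x y))

  ⊑-on-points : ∀ {s t : Relation (Fin 3)} → (s on colour) ⊑ (t on colour) →
                ∀ i j → T (s (inject₁ i) (inject₁ j)) → T (t (inject₁ i) (inject₁ j))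
  ⊑-on-points {s} {t} le i j =
    subst T (on-point t i j) ∘ le (point i) (point j) ∘ subst T (sym (on-point s i j))

  W₁-between : Between (w₁ on colour)
  W₁-between = record
    { lower  = λ x y → from-yes (u ⊑? w₁) (colour x) (colour y)
    ; upper  = λ x y → from-yes (w₁ ⊑? v) (colour x) (colour y)
    -- One table entry refutes each inclusion: (a, b) is in `w₁` but not in `u`, and (b, a) is in
    -- `v` but not in `w₁`.
    ; lower≉ = λ le → ⊑-on-points {w₁} {u} le 0F 1F tt
    ; upper≉ = λ le → ⊑-on-points {v} {w₁} le 1F 0F tt
    }

  W₂-between : Between (w₂ on colour)
  W₂-between = record
    { lower  = λ x y → from-yes (u ⊑? w₂) (colour x) (colour y)
    ; upper  = λ x y → from-yes (w₂ ⊑? v) (colour x) (colour y)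
    ; lower≉ = λ le → ⊑-on-points {w₂} {u} le 0F 1F tt
    ; upper≉ = λ le → ⊑-on-points {v} {w₂} le 1F 0F tt
    }

  W₃-between : Between (w₃ on colour)
  W₃-between = record
    { lower  = λ x y → from-yes (u ⊑? w₃) (colour x) (colour y)
    ; upper  = λ x y → from-yes (w₃ ⊑? v) (colour x) (colour y)
    ; lower≉ = λ le → ⊑-on-points {w₃} {u} le 1F 0F tt
    ; upper≉ = λ le → ⊑-on-points {v} {w₃} le 0F 1F tt
    }

  -- If (b, a) were missing too, transitivity of the complement would remove all of A × A from `W`.
  -- Being below `V`, it would then lie below `U`.
  oriented : ∀ {W} → IsBipartitional W → Between W →
             ¬ T (W (point 0F) (point 1F)) → T (W (point 1F) (point 0F))
  oriented {W} (_ , ∁-trans) bw ¬ab = decidable-stable (T? _) λ ¬ba → lower≉ bw (W⊑U ¬ba)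
    where
    W⊑U : ¬ T (W (point 1F) (point 0F)) → W ⊑ U
    W⊑U ¬ba x y Wxy with upper bw x y Wxy | point⊎rest x | point⊎rest y
    ... | _   | inj₁ (i , refl) | inj₁ (j , refl) =
      contradiction Wxy (transitive⇒full-on-points {∁⟦ W ⟧} (λ {a} {b} {c} → ∁-trans {a} {b} {c}) ¬ab ¬ba i j)
    ... | _   | inj₁ (0F , refl) | inj₂ eq rewrite colour-point 0F | eq = tt
    ... | _   | inj₁ (1F , refl) | inj₂ eq rewrite colour-point 1F | eq = tt
    ... | Vxy | inj₂ eq | _ rewrite eq = Vxy

  -- Dually, both pairs would fill A × A by transitivity. Since `U` supplies A × (X ∖ A), `W` would
  -- contain `V`.
  ¬both : ∀ {W} → IsBipartitional W → Between W →
          T (W (point 0F) (point 1F)) → ¬ T (W (point 1F) (point 0F))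
  ¬both {W} (W-trans , _) bw ab ba = upper≉ bw V⊑W
    where
    V⊑W : V ⊑ W
    V⊑W x y Vxy with point⊎rest x | point⊎rest y
    ... | inj₁ (i , refl) | inj₁ (j , refl) =
      transitive⇒full-on-points {⟦ W ⟧} (λ {a} {b} {c} → W-trans {a} {b} {c}) ab ba i j
    ... | inj₁ (i , refl) | inj₂ eq = lower bw (point i) y (Ux i)
      where
      Ux : ∀ i → T (U (point i) y)
      Ux 0F rewrite colour-point 0F | eq = tt
      Ux 1F rewrite colour-point 1F | eq = tt
    ... | inj₂ eq | _ rewrite eq = ⊥-elim Vxy

  -- If only the larger relation contained (a, b), the smaller would contain (b, a) and pass it on,
  -- giving the larger one both pairs.
  ⊑⇒same-orientation : ∀ {W W′} → IsBipartitional W → IsBipartitional W′ → Between W → Between W′ → W ⊑ W′ →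
                       W (point 0F) (point 1F) ≡ W′ (point 0F) (point 1F)
  ⊑⇒same-orientation {W} {W′} bip bip′ bw bw′ le
    with W (point 0F) (point 1F) in eq | W′ (point 0F) (point 1F) in eq′
  ... | true  | true  = refl
  ... | false | false = refl
  ... | true  | false = ⊥-elim (subst T eq′ (le _ _ (subst T (sym eq) tt)))
  ... | false | true  = contradiction (le _ _ (oriented bip bw (subst T eq)))
                                      (¬both bip′ bw′ (subst T (sym eq′) tt))

  -- The link of a largest chain outside the interval

  module _ (fin : Finite (DecPoset.Eq.setoid (properBipPoset X-fin))) where

    private
      module fin = Inverse (proj₂ fin)

      K : SimplicialComplex (proj₁ fin)
      K = orderComplex (properBipPoset X-fin) fin

    rel : Fin (proj₁ fin) → Relation X
    rel = proj₁ ∘ proj₁ ∘ fin.to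

    rel-bipartitional : ∀ i → IsBipartitional (rel i)
    rel-bipartitional i = proj₂ (proj₁ (fin.to i))

    position : (B : Bip X) → IsProper X-fin B → Fin (proj₁ fin)
    position B B-proper = fin.from (B , B-proper)

    rel-position : ∀ B B-proper x y → rel (position B B-proper) x y ≡ proj₁ B x y
    rel-position B B-proper = fin.strictlyInverseˡ (B , B-proper)

    singleton-face : ∀ i → Face K ⁅ i ⁆
    singleton-face i x y x∈ y∈ with refl ← x∈⁅y⁆⇒x≡y i x∈ | refl ← x∈⁅y⁆⇒x≡y i y∈ = inj₁ (λ _ _ → id)

    ∪-face : ∀ {σ τ} → Face K σ → Face K τ →
             (∀ i j → i ∈ σ → j ∈ τ → rel i ⊑ rel j ⊎ rel j ⊑ rel i) → Face K (σ ∪ τ)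
    ∪-face {σ} {τ} σ∈K τ∈K cross x y x∈ y∈ with x∈p∪q⁻ σ τ x∈ | x∈p∪q⁻ σ τ y∈
    ... | inj₁ x∈σ | inj₁ y∈σ = σ∈K x y x∈σ y∈σ
    ... | inj₁ x∈σ | inj₂ y∈τ = cross x y x∈σ y∈τ
    ... | inj₂ x∈τ | inj₁ y∈σ = swap (cross y x y∈σ x∈τ)
    ... | inj₂ x∈τ | inj₂ y∈τ = τ∈K x y x∈τ y∈τ

    Outside : Relation X → Set
    Outside W = W ⊑ U ⊎ V ⊑ W

    OutsideChain : Subset (proj₁ fin) → Set
    OutsideChain σ = Face K σ × (∀ i → i ∈ σ → Outside (rel i))

    outsideChain? : ∀ σ → Dec (OutsideChain σ)
    outsideChain? σ = face? K σ ×-dec all? λ i → (i ∈? σ) →-dec ((rel i ≤? U) ⊎-dec (V ≤? rel i))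

    module _ {σ : Subset (proj₁ fin)} (σ∈K : Face K σ) (σ-outside : ∀ i → i ∈ σ → Outside (rel i))
             (σ-largest : ∀ ρ → OutsideChain ρ → ∣ ρ ∣ ≤ ∣ σ ∣) where

      σ-maximal : ∀ i → Face K (σ ∪ ⁅ i ⁆) → Outside (rel i) → i ∈ σ
      σ-maximal i face out = decidable-stable (i ∈? σ) λ i∉σ →
        <⇒≱ (∣p∪⁅x⁆∣>∣p∣ i∉σ) (σ-largest (σ ∪ ⁅ i ⁆) (face , extended-outside))
        where
        extended-outside : ∀ j → j ∈ σ ∪ ⁅ i ⁆ → Outside (rel j)
        extended-outside j j∈ with x∈p∪q⁻ σ ⁅ i ⁆ j∈
        ... | inj₁ j∈σ = σ-outside j j∈σ
        ... | inj₂ j∈i with refl ← x∈⁅y⁆⇒x≡y i j∈i = out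

      L : SimplicialComplex (proj₁ fin)
      L = link K σ σ∈K

      -- Members of `σ` lie below `U` or above `V`, hence are comparable with everything in between
      -- and never strictly between themselves.
      between⇒link : ∀ τ → Face K τ → (∀ i → i ∈ τ → Between (rel i)) → Face L τ
      between⇒link τ τ∈K τ-between = disjoint , ∪-face σ∈K τ∈K cross
        where
        disjoint : Empty (σ ∩ τ)
        disjoint (i , i∈) with x∈p∩q⁻ σ τ i∈
        ... | i∈σ , i∈τ = [ lower≉ (τ-between i i∈τ) , upper≉ (τ-between i i∈τ) ]′ (σ-outside i i∈σ)

        cross : ∀ i j → i ∈ σ → j ∈ τ → rel i ⊑ rel j ⊎ rel j ⊑ rel i
        cross i j i∈σ j∈τ with σ-outside i i∈σ
        ... | inj₁ i⊑U = inj₁ λ x y → lower (τ-between j j∈τ) x y ∘ i⊑U x y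
        ... | inj₂ V⊑i = inj₂ λ x y → V⊑i x y ∘ upper (τ-between j j∈τ) x y

      -- Used for `B` equal to `U` or `V`. Such a `B` is comparable with all of `σ`, so maximality
      -- puts it into `σ`, and whatever extends `σ` to a chain is comparable with it.
      comparable-with-σ : (B : Bip X) → IsProper X-fin B → Outside (proj₁ B) →
                          (∀ W → Outside W → W ⊑ proj₁ B ⊎ proj₁ B ⊑ W) →
                          ∀ i → Face K (σ ∪ ⁅ i ⁆) → rel i ⊑ proj₁ B ⊎ proj₁ B ⊑ rel i
      comparable-with-σ (B , bip) proper B-outside B-comparable i face
        = ⊎-map (λ i⊑b x y → b⊑B x y ∘ i⊑b x y) (λ b⊑i x y → b⊑i x y ∘ B⊑b x y)
            (face i b (q⊆p∪q σ ⁅ i ⁆ (x∈⁅x⁆ i)) (p⊆p∪q ⁅ i ⁆ b∈σ))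
        where
        b : Fin (proj₁ fin)
        b = position (B , bip) proper

        b⊑B : rel b ⊑ B
        b⊑B x y = subst T (rel-position (B , bip) proper x y)

        B⊑b : B ⊑ rel b
        B⊑b x y = subst T (sym (rel-position (B , bip) proper x y))

        cross : ∀ s j → s ∈ σ → j ∈ ⁅ b ⁆ → rel s ⊑ rel j ⊎ rel j ⊑ rel s
        cross s j s∈σ j∈ with refl ← x∈⁅y⁆⇒x≡y b j∈ | B-comparable (rel s) (σ-outside s s∈σ)
        ... | inj₁ s⊑B = inj₁ λ x y → B⊑b x y ∘ s⊑B x y
        ... | inj₂ B⊑s = inj₂ λ x y → B⊑s x y ∘ b⊑B x y

        b-outside : Outside (rel b)
        b-outside = ⊎-map (λ B⊑U x y → B⊑U x y ∘ b⊑B x y) (λ V⊑B x y → B⊑b x y ∘ V⊑B x y) B-outside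

        b∈σ : b ∈ σ
        b∈σ = σ-maximal b (∪-face σ∈K (singleton-face b) cross) b-outside

      link⇒between : ∀ i → Face L ⁅ i ⁆ → Between (rel i)
      link⇒between i (disjoint , face) = record
        -- If a and b exhaust `X`, then `U` is empty and not a vertex. Assuming `U⋢i` rules this
        -- out, and `U` is not full because (a, a) is missing.
        { lower  = decidable-stable (U ≤? rel i) λ U⋢i →
            [ i⋢U , U⋢i ]′ (comparable-with-σ (U , on-bipartitional colour u-bipartitional)
              ( (λ U≈∅ → U⋢i λ x y Uxy → ⊥-elim (subst T (U≈∅ x y) Uxy))
              , (λ U≈⊤ → case trans (sym (U≈⊤ (point 0F) (point 0F))) (on-point u 0F 0F) of λ ()) )
              (inj₁ λ _ _ → id)
              (λ W → [ inj₁ , (λ V⊑W → inj₂ λ x y → V⊑W x y ∘ U⊑V x y) ]′)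
              i face)
        -- Dually, `V` could be all of X × X. Assuming `i⋢V` rules this out, and (a, a) shows that
        -- `V` is nonempty.
        ; upper  = decidable-stable (rel i ≤? V) λ i⋢V →
            [ i⋢V , V⋢i ]′ (comparable-with-σ (V , on-bipartitional colour v-bipartitional)
              ( (λ V≈∅ → case trans (sym (V≈∅ (point 0F) (point 0F))) (on-point v 0F 0F) of λ ())
              , (λ V≈⊤ → i⋢V λ x y _ → subst T (sym (V≈⊤ x y)) tt) )
              (inj₂ λ _ _ → id)
              (λ W → [ (λ W⊑U → inj₁ λ x y → U⊑V x y ∘ W⊑U x y) , inj₂ ]′)
              i face)
        ; lower≉ = i⋢U
        ; upper≉ = V⋢i
        }
        where
        i∉σ : i ∉ σ
        i∉σ i∈σ = disjoint (i , x∈p∩q⁺ (i∈σ , x∈⁅x⁆ i))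

        i⋢U : ¬ rel i ⊑ U
        i⋢U = i∉σ ∘ σ-maximal i face ∘ inj₁

        V⋢i : ¬ V ⊑ rel i
        V⋢i = i∉σ ∘ σ-maximal i face ∘ inj₂

      between⇒proper : (B : Bip X) → Between (proj₁ B) → IsProper X-fin B
      between⇒proper B bw =
          (λ B≈∅ → lower≉ bw λ x y Bxy → ⊥-elim (subst T (B≈∅ x y) Bxy))
        , (λ B≈⊤ → upper≉ bw λ x y _ → subst T (sym (B≈⊤ x y)) tt)

      -- The enumeration returns a relation that agrees with the pullback of `t` only pointwise, so
      -- facts are transported along `rel-vertex`.
      module Vertex {t : Relation (Fin 3)} (t-bipartitional : IsBipartitional t) (t-between : Between (t on colour)) where

        private
          B : Bip X
          B = (t on colour) , on-bipartitional colour t-bipartitional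

        vertex : Fin (proj₁ fin)
        vertex = position B (between⇒proper B t-between)

        rel-vertex : ∀ x y → rel vertex x y ≡ (t on colour) x y
        rel-vertex = rel-position B (between⇒proper B t-between)

        rel-vertex-point : ∀ i j → rel vertex (point i) (point j) ≡ t (inject₁ i) (inject₁ j)
        rel-vertex-point i j = trans (rel-vertex _ _) (on-point t i j)

        vertex-between : Between (rel vertex)
        vertex-between = Between-resp (λ x y → sym (rel-vertex x y)) t-between

        vertex-link : Face L ⁅ vertex ⁆
        vertex-link = between⇒link ⁅ vertex ⁆ (singleton-face vertex)
          λ i i∈ → subst (Between ∘ rel) (sym (x∈⁅y⁆⇒x≡y vertex i∈)) vertex-between

      private
        module W₁ = Vertex w₁-bipartitional W₁-between
        module W₂ = Vertex w₂-bipartitional W₂-between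
        module W₃ = Vertex w₃-bipartitional W₃-between

      W₁≢W₂ : W₁.vertex ≢ W₂.vertex
      -- The pair (a, a) separates them.
      W₁≢W₂ eq = case trans (sym (W₁.rel-vertex-point 0F 0F))
        (trans (cong (λ i → rel i (point 0F) (point 0F)) eq) (W₂.rel-vertex-point 0F 0F)) of λ ()

      W₁W₂-link : Face L (⁅ W₁.vertex ⁆ ∪ ⁅ W₂.vertex ⁆)
      W₁W₂-link = between⇒link _ (∪-face (singleton-face _) (singleton-face _) cross) between
        where
        W₁⊑W₂ : rel W₁.vertex ⊑ rel W₂.vertex
        W₁⊑W₂ x y = subst T (sym (W₂.rel-vertex x y)) ∘ from-yes (w₁ ⊑? w₂) (colour x) (colour y)
                  ∘ subst T (W₁.rel-vertex x y)

        cross : ∀ i j → i ∈ ⁅ W₁.vertex ⁆ → j ∈ ⁅ W₂.vertex ⁆ → rel i ⊑ rel j ⊎ rel j ⊑ rel i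
        cross i j i∈ j∈ with refl ← x∈⁅y⁆⇒x≡y W₁.vertex i∈ | refl ← x∈⁅y⁆⇒x≡y W₂.vertex j∈ = inj₁ W₁⊑W₂

        between : ∀ i → i ∈ ⁅ W₁.vertex ⁆ ∪ ⁅ W₂.vertex ⁆ → Between (rel i)
        between i i∈ with x∈p∪q⁻ ⁅ W₁.vertex ⁆ ⁅ W₂.vertex ⁆ i∈
        ... | inj₁ i∈₁ with refl ← x∈⁅y⁆⇒x≡y W₁.vertex i∈₁ = W₁.vertex-between
        ... | inj₂ i∈₂ with refl ← x∈⁅y⁆⇒x≡y W₂.vertex i∈₂ = W₂.vertex-between

      -- The two-colouring for the link: between `U` and `V`, it tells which one of (a, b) and (b,
      -- a) is present.
      orientation : Fin (proj₁ fin) → Bool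
      orientation i = rel i (point 0F) (point 1F)

      edge⇒same-orientation : ∀ i j → Face L (⁅ i ⁆ ∪ ⁅ j ⁆) → orientation i ≡ orientation j
      edge⇒same-orientation i j face =
        [ same i j i-between j-between , sym ∘ same j i j-between i-between ]′
          (proj₂ face i j (in-∪ (inj₁ (x∈⁅x⁆ i))) (in-∪ (inj₂ (x∈⁅x⁆ j))))
        where
        in-∪ : ∀ {x} → x ∈ ⁅ i ⁆ ⊎ x ∈ ⁅ j ⁆ → x ∈ σ ∪ (⁅ i ⁆ ∪ ⁅ j ⁆)
        in-∪ = q⊆p∪q σ (⁅ i ⁆ ∪ ⁅ j ⁆) ∘ x∈p∪q⁺

        i-between : Between (rel i)
        i-between = link⇒between i (⊆-close L (p⊆p∪q ⁅ j ⁆) face)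

        j-between : Between (rel j)
        j-between = link⇒between j (⊆-close L (q⊆p∪q ⁅ i ⁆ ⁅ j ⁆) face)

        same : ∀ i j → Between (rel i) → Between (rel j) → rel i ⊑ rel j → orientation i ≡ orientation j
        same i j = ⊑⇒same-orientation {rel i} {rel j} (rel-bipartitional i) (rel-bipartitional j)

      largest⇒¬CohenMacaulay : ∀ {c ℓ} (R : CommutativeRing c ℓ) → Nontrivial R → ¬ CohenMacaulay R K
      largest⇒¬CohenMacaulay R nontrivial cm with edge⇒positiveDimension L W₁≢W₂ W₁W₂-link
      -- `W₁` contains (a, b) and `W₃` does not, so these vertices lie on different sides.
      ... | d , L-dim , 0<d = disconnected⇒¬vanishing R L W₁.vertex-link W₃.vertex-link orientation
        (W₁.rel-vertex-point 0F 1F) (W₃.rel-vertex-point 0F 1F) edge⇒same-orientation nontrivial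
        (cm σ σ∈K d L-dim (+ 0) 0<d)

    properBip-¬CohenMacaulay : ∀ {c ℓ} (R : CommutativeRing c ℓ) → Nontrivial R → ¬ CohenMacaulay R K
    -- The empty chain starts the search for a largest one.
    properBip-¬CohenMacaulay R nontrivial with maximum outsideChain? ∅ (∅-face K , λ i i∈ → contradiction i∈ ∉⊥)
    ... | σ , (σ∈K , σ-outside) , σ-largest = largest⇒¬CohenMacaulay σ∈K σ-outside σ-largest R nontrivial

corollary9p4 : ∀ {c ℓ} (R : CommutativeRing c ℓ) → Nontrivial R →
    (X : Set) (n : ℕ) (X-fin : Fin n ↔ X) → 2 ≤ n →
    ¬ CohenMacaulay R (orderComplex (properBipPoset X-fin) (properBip-finite X-fin))
corollary9p4 R nontrivial X (suc (suc k)) X-fin (s≤s (s≤s z≤n)) =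
  properBip-¬CohenMacaulay X-fin (properBip-finite X-fin) R nontrivial
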